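{- Let $a,b,c$ be three distinct positive integers with $a<c$ and $b<c$, and let $S=\{a,b,c\}$. Then $S$ forces discrepancy two if and only if $a+b=c$ and $\nu_2(a)\neq\nu_2(b)$. Moreover, in that case the skip graph $G(S)$ contains a cycle of length $3$ but contains no odd cycle of any other length.
   Context: $\nu_2(n)$ denotes the exponent of $2$ in the prime factorization of the positive integer $n$. A finite set $S$ of positive integers forces discrepancy two if for every sequence $(x_n)_{n\ge1}$ with $x_n\in\{+1,-1\}$ there exist $s\in S$ and an integer $k\ge1$ with $\left|\sum_{i=1}^k x_{is}\right|>1$. The skip graph $G(S)$ is the simple graph with vertex set $\mathbb{N}=\{0,1,2,\dots\}$ in which, for each $s\in S$ and each integer $j\ge 0$, the vertices $2js$ and $(2j+1)s$ are joined by an edge (called an $s$-arc). A cycle means a graph cycle (length at least 3, distinct vertices); an odd cycle is a cycle of odd length. -}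

module Defs where

open import Data.Nat using (ℕ; zero; suc; _+_; _*_; _<_; _≤_; _%_; _/_)
open import Data.Nat.Properties using (_≟_)
open import Data.Integer as ℤ using (ℤ; ∣_∣)
open import Data.List using (List)
open import Data.List.Membership.Propositional using (_∈_)
open import Data.Product using (Σ; ∃; _×_)
open import Data.Sum using (_⊎_)
open import Relation.Binary.PropositionalEquality using (_≡_)
open import Relation.Nullary using (yes; no)

-- 2-adic valuation ν₂(n): exponent of 2 in n (convention ν₂ 0 = 0, irrelevant here).
-- Fuel-based recursion; fuel n suffices since ν₂ n ≤ n.
ν₂-go : ℕ → ℕ → ℕ
ν₂-go zero    n       = 0
ν₂-go (suc f) zero    = 0
ν₂-go (suc f) (suc m) with suc m % 2 ≟ 0
... | yes _ = suc (ν₂-go f (suc m / 2))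
... | no  _ = 0

ν₂ : ℕ → ℕ
ν₂ n = ν₂-go n n

-- A ±1 sequence (x n)_{n ≥ 1}; the value at index 0 is unused.
IsSignSeq : (ℕ → ℤ) → Set
IsSignSeq x = ∀ n → x n ≡ ℤ.+ 1 ⊎ x n ≡ ℤ.- (ℤ.+ 1)

partialSum : (ℕ → ℤ) → ℕ → ℕ → ℤ
partialSum x s zero    = ℤ.+ 0
partialSum x s (suc k) = partialSum x s k ℤ.+ x (suc k * s)

ForcesDisc2 : List ℕ → Set
ForcesDisc2 S = ∀ (x : ℕ → ℤ) → IsSignSeq x →
  Σ ℕ λ s → Σ ℕ λ k → s ∈ S × 1 ≤ k × 1 < ∣ partialSum x s k ∣

Adj : List ℕ → ℕ → ℕ → Set
Adj S u v = Σ ℕ λ s → Σ ℕ λ j → s ∈ S ×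
  ((u ≡ 2 * j * s × v ≡ (2 * j + 1) * s) ⊎ (v ≡ 2 * j * s × u ≡ (2 * j + 1) * s))

HasCycle : List ℕ → ℕ → Set
HasCycle S L = Σ (ℕ → ℕ) λ f →
  3 ≤ L ×
  (∀ i j → i < L → j < L → f i ≡ f j → i ≡ j) ×
  (∀ i → i < L → Adj S (f i) (f (suc i))) ×
  f L ≡ f 0

{-# OPTIONS --safe #-}
module Submission where

-- Bounded partial sums mean that x takes opposite values at k s and (k + 1) s for every
-- odd k and every s ∈ S, so S fails to force discrepancy two iff the graph G′(S) with these
-- edges is 2-colourable; n ↦ 2 P − n, for P a common multiple of S, turns G(S) into G′(S).
-- Halve until a, b, c are not all even. An odd element of S joins odd to even numbers,
-- so only the case of exactly two odd elements x < z and an even y can fail to be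
-- 2-colourable. There, an odd multiple n of both x and z makes n + x and n + z equal in
-- colour, while y-arcs demand opposite colours. An explicit colouring meets all these
-- demands unless y = z − x; then it fails only at y-arcs with upper end divisible by 2 z.
-- Around such an arc the graph is a triangle with pendant edges, so a cycle through it
-- has length 3. The triangle exists by Bézout's identity.

open import Defs
open import Data.Nat using (ℕ; _+_; _<_; _%_)
open import Data.List using (_∷_; [])
open import Data.Product using (_×_)
open import Function.Bundles using (_⇔_)
open import Relation.Binary.PropositionalEquality using (_≡_; _≢_)
open import Relation.Nullary using (¬_)

open import Data.Integer as ℤ using (ℤ)
open import Data.List using (List; map)
open import Data.List.Membership.Propositional using (_∈_)
open import Data.List.Membership.Propositional.Properties using (∈-map⁺; ∈-map⁻)
open import Data.List.Relation.Binary.Subset.Propositional using (_⊆_)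
open import Data.List.Relation.Unary.All using (All; []; _∷_)
open import Data.List.Relation.Unary.Any using (here; there)
open import Data.Nat using (zero; suc; _*_; _∸_; _≤_; _/_; parity; NonZero; z≤n; s≤s; s≤s⁻¹;
  >-nonZero; >-nonZero⁻¹; ≢-nonZero; ≢-nonZero⁻¹)
open import Data.Nat.Coprimality using (Coprime; coprime-Bézout; coprime-divisor; coprime-/gcd)
open import Data.Nat.DivMod
open import Data.Nat.Divisibility
open import Data.Nat.GCD using (module Bézout; gcd; gcd[m,n]∣m; gcd[m,n]∣n; gcd[m,n]≢0)
open import Data.Nat.ListAction using (product)
open import Data.Nat.ListAction.Properties using (∈⇒∣product; product≢0)
open import Data.Nat.Properties
open import Data.Nat.Tactic.RingSolver using (solve-∀)
open import Data.Parity.Base as ℙ using (Parity; 0ℙ; 1ℙ; _⁻¹)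
open import Data.Parity.Properties using (⁻¹-involutive; p≢p⁻¹; +-homo-+; *-homo-*)
open import Data.Product using (Σ; ∃; _,_; proj₁; proj₂)
open import Data.Sum as Sum using (_⊎_; inj₁; inj₂; [_,_]′)
open import Function using (_∘_; id)
open import Function.Bundles using (mk⇔)
open import Relation.Binary.Definitions using (tri<; tri≈; tri>)
open import Relation.Binary.PropositionalEquality using
  (refl; sym; trans; cong; cong₂; subst; subst₂; module ≡-Reasoning)
open import Relation.Nullary using (Dec; yes; no; contradiction)
open import Relation.Nullary.Decidable using (_×-dec_; _⊎-dec_; ¬?; decidable-stable)

-- Parity of natural numbers.

Even Odd : ℕ → Set
Even n = parity n ≡ 0ℙ
Odd n = parity n ≡ 1ℙ

parity-suc : ∀ n → parity (suc n) ≡ parity n ⁻¹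
parity-suc zero = refl
parity-suc (suc zero) = refl
parity-suc (suc (suc n)) = parity-suc n

even-or-odd : ∀ n → Even n ⊎ Odd n
even-or-odd n with parity n
... | 0ℙ = inj₁ refl
... | 1ℙ = inj₂ refl

¬even×odd : ∀ n → Even n → ¬ Odd n
¬even×odd n e o with () ← trans (sym e) o

odd⇒suc-even : ∀ n → Odd n → Even (suc n)
odd⇒suc-even n o = trans (parity-suc n) (cong _⁻¹ o)

even⇒suc-odd : ∀ n → Even n → Odd (suc n)
even⇒suc-odd n e = trans (parity-suc n) (cong _⁻¹ e)

+-even-odd : ∀ m n → Even m → Odd n → Odd (m + n)
+-even-odd m n em on rewrite +-homo-+ m n | em | on = refl

+-odd-even : ∀ m n → Odd m → Even n → Odd (m + n)
+-odd-even m n om en rewrite +-homo-+ m n | om | en = refl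

*-odd-odd : ∀ m n → Odd m → Odd n → Odd (m * n)
*-odd-odd m n om on rewrite *-homo-* m n | om | on = refl

*-evenˡ : ∀ m n → Even m → Even (m * n)
*-evenˡ m n em rewrite *-homo-* m n | em = refl

*-evenʳ : ∀ m n → Even n → Even (m * n)
*-evenʳ m n en = trans (cong parity (*-comm m n)) (*-evenˡ n m en)

even≢odd*odd : ∀ {n} k s → Even n → Odd k → Odd s → n ≢ k * s
even≢odd*odd {n} k s en ok os eq = ¬even×odd n en (trans (cong parity eq) (*-odd-odd k s ok os))

odd*⇒oddˡ : ∀ m n → Odd (m * n) → Odd m
odd*⇒oddˡ m n o with even-or-odd m
... | inj₁ e = contradiction o (¬even×odd (m * n) (*-evenˡ m n e))
... | inj₂ o = o

odd*⇒oddʳ : ∀ m n → Odd (m * n) → Odd n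
odd*⇒oddʳ m n o = odd*⇒oddˡ n m (trans (cong parity (*-comm n m)) o)

even⇒2* : ∀ n → Even n → ∃ λ k → n ≡ 2 * k
even⇒2* zero e = 0 , refl
even⇒2* (suc (suc n)) e with k , refl ← even⇒2* n e = suc k , cong suc (sym (+-suc k (k + 0)))

odd⇒1+2* : ∀ n → Odd n → ∃ λ k → n ≡ suc (2 * k)
odd⇒1+2* (suc n) o with even-or-odd n
... | inj₁ e with k , refl ← even⇒2* n e = k , refl
... | inj₂ o′ = contradiction o (¬even×odd (suc n) (odd⇒suc-even n o′))

-- Proper colourings and the easy parity patterns.

Proper : (ℕ → Parity) → ℕ → Set
Proper χ s = ∀ k → Odd k → χ (suc k * s) ≡ χ (k * s) ⁻¹

proper-parity : ∀ s → Odd s → Proper parity s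
proper-parity s os k ok
  rewrite *-odd-odd k s ok os | *-evenˡ (suc k) s (odd⇒suc-even k ok) = refl

-- For odd `u` every `u`-arc leads from an odd `n` up to the even `u + n`. This colouring settles
-- all `u`-arcs and leaves the colours of even numbers free.
extend : (ℕ → Parity) → ℕ → ℕ → Parity
extend χ u n with parity n
... | 0ℙ = χ n
... | 1ℙ = χ (u + n) ⁻¹

module _ (χ : ℕ → Parity) (u : ℕ) where

  extend-even : ∀ n → Even n → extend χ u n ≡ χ n
  extend-even n e rewrite e = refl

  extend-odd : ∀ n → Odd n → extend χ u n ≡ χ (u + n) ⁻¹
  extend-odd n o rewrite o = refl

  extend-proper-even : ∀ s → Even s → Proper χ s → Proper (extend χ u) s
  extend-proper-even s es p k ok
    rewrite extend-even (k * s) (*-evenʳ k s es)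
          | extend-even (suc k * s) (*-evenʳ (suc k) s es) = p k ok

  -- The lower end `k * s` is odd and gets the colour opposite to `χ (u + k * s)`; the upper end
  -- `s + k * s` is even and keeps its colour. A second odd element thus becomes a demand for equal
  -- colours on even numbers.
  extend-proper-odd : ∀ s → Odd s → (∀ k → Odd k → χ (u + k * s) ≡ χ (s + k * s)) →
                      Proper (extend χ u) s
  extend-proper-odd s os eq k ok
    rewrite extend-odd (k * s) (*-odd-odd k s ok os)
          | extend-even (suc k * s) (*-evenˡ (suc k) s (odd⇒suc-even k ok))
          | ⁻¹-involutive (χ (u + k * s)) = sym (eq k ok)

  extend-proper-self : Odd u → Proper (extend χ u) u
  extend-proper-self ou = extend-proper-odd u ou λ _ _ → refl

quotientParity : ∀ y .{{_ : NonZero y}} → ℕ → Parity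
quotientParity y n = parity (n / y)

quotientParity-* : ∀ y .{{_ : NonZero y}} k → quotientParity y (k * y) ≡ parity k
quotientParity-* y k = cong parity (m*n/n≡m k y)

quotientParity-proper : ∀ y .{{_ : NonZero y}} → Proper (quotientParity y) y
quotientParity-proper y k ok
  rewrite quotientParity-* y k | quotientParity-* y (suc k) = parity-suc k

Colourable : ℕ → ℕ → ℕ → Set
Colourable a b c = ∃ λ χ → Proper χ a × Proper χ b × Proper χ c

rotate : ∀ {a b c} → Colourable a b c → Colourable b c a
rotate (χ , p , q , r) = χ , q , r , p

swap₁₂ : ∀ {a b c} → Colourable a b c → Colourable b a c
swap₁₂ (χ , p , q , r) = χ , q , p , r

colourable-ooo : ∀ a b c → Odd a → Odd b → Odd c → Colourable a b c
colourable-ooo a b c oa ob oc = parity , proper-parity a oa , proper-parity b ob , proper-parity c oc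

-- Keeps the fuel sufficient in the recursions that halve their arguments.
half≤ : ∀ m {f} .{{_ : NonZero m}} → 2 * m ≤ suc f → m ≤ f
half≤ (suc m) (s≤s le) = m+n≤o⇒n≤o m (≤-trans (≤-reflexive (cong (m +_) (sym (+-identityʳ (suc m))))) le)

-- Halving carries each arc of `2 * s` onto the arc of `s` with the same `k`.
proper-double : ∀ χ s → Proper χ s → Proper (λ n → χ (n / 2)) (2 * s)
proper-double χ s p k ok = begin
  χ (suc k * (2 * s) / 2) ≡⟨ cong χ (eq (suc k)) ⟩
  χ (suc k * s)           ≡⟨ p k ok ⟩
  χ (k * s) ⁻¹            ≡⟨ cong (_⁻¹ ∘ χ) (eq k) ⟨
  χ (k * (2 * s) / 2) ⁻¹  ∎
  where
  open ≡-Reasoning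
  eq : ∀ k → k * (2 * s) / 2 ≡ k * s
  eq k = trans (cong (_/ 2) (trans (cong (k *_) (*-comm 2 s)) (sym (*-assoc k s 2)))) (m*n/n≡m (k * s) 2)

-- Halve until `t` or `u` is odd. If only one is, `extend` settles it on top of the quotient
-- colouring for the even one; if both are, `parity` works.
two-colourable : ∀ t u → 0 < t → 0 < u → ∃ λ χ → Proper χ t × Proper χ u
two-colourable t u 0<t 0<u = go t t u ≤-refl 0<t 0<u where
  go : ∀ f t u → t ≤ f → 0 < t → 0 < u → ∃ λ χ → Proper χ t × Proper χ u
  go zero (suc t) u () 0<t 0<u
  go (suc f) t@(suc _) u@(suc _) t≤1+f 0<t 0<u with even-or-odd t | even-or-odd u
  ... | inj₁ et | inj₂ ou =
    extend χ u , extend-proper-even χ u t et (quotientParity-proper t) , extend-proper-self χ u ou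
    where χ = quotientParity t
  ... | inj₂ ot | inj₁ eu =
    extend χ t , extend-proper-self χ t ot , extend-proper-even χ t u eu (quotientParity-proper u)
    where χ = quotientParity u
  ... | inj₂ ot | inj₂ ou = parity , proper-parity t ot , proper-parity u ou
  ... | inj₁ et | inj₁ eu with even⇒2* t et | even⇒2* u eu
  ... | t′@(suc _) , refl | u′@(suc _) , refl
    with χ , p , q ← go f t′ u′ (half≤ t′ t≤1+f) (s≤s z≤n) (s≤s z≤n) =
    (λ n → χ (n / 2)) , proper-double χ t′ p , proper-double χ u′ q

colourable-eeo : ∀ a b c → 0 < a → 0 < b → Even a → Even b → Odd c → Colourable a b c
colourable-eeo a b c 0<a 0<b ea eb oc with χ , p , q ← two-colourable a b 0<a 0<b =
  extend χ c , extend-proper-even χ c a ea p , extend-proper-even χ c b eb q , extend-proper-self χ c oc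

-- Two odd elements `x` and `x + D` and an even element `y`.

module TwoOdd (x D y : ℕ) .{{_ : NonZero x}} .{{_ : NonZero D}} .{{_ : NonZero y}} where

  z : ℕ
  z = x + D

  D<z : D < z
  D<z = m<n+m D {x} (>-nonZero⁻¹ x)

  D<2z : D < 2 * z
  D<2z = <-≤-trans D<z (m≤m+n z (z + 0))

  -- For D < y at most one of n and n + D is a multiple of y; if 2 z ∣ n + D, the other takes its colour.
  far : ℕ → Parity
  far n with y ∣? n | (2 * z) ∣? (n + D) | y ∣? (n ∸ D)
  ... | yes _ | _     | _     = quotientParity y n
  ... | no _  | yes _ | _     = quotientParity y (n + D)
  ... | no _  | no _  | yes _ = quotientParity y (n ∸ D)
  ... | no _  | no _  | no _  = quotientParity y n

  far-∣ : ∀ n → y ∣ n → far n ≡ quotientParity y n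
  far-∣ n y∣n with y ∣? n | (2 * z) ∣? (n + D) | y ∣? (n ∸ D)
  ... | yes _ | _     | _     = refl
  ... | no y∤n  | _ | _     = contradiction y∣n y∤n

  far-proper : Proper far y
  far-proper k ok rewrite far-∣ (k * y) (n∣m*n k) | far-∣ (suc k * y) (n∣m*n (suc k)) =
    quotientParity-proper y k ok

  -- If `y ∣ n`, then `y` does not divide `n + D`, which copies the colour of `n` by the third
  -- clause. Otherwise `n` copies `n + D` by the second clause. That clause never applies to `n + D`
  -- itself, because `2 * z` does not divide `D`.
  far-shift : D < y → ∀ n → 2 * z ∣ n + D → far n ≡ far (n + D)
  far-shift D<y n 2z∣ with y ∣? n | (2 * z) ∣? (n + D) | y ∣? (n ∸ D)
  far-shift D<y n 2z∣ | yes y∣n | _ | _ with y ∣? (n + D) | (2 * z) ∣? (n + D + D) | y ∣? (n + D ∸ D)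
  ... | yes y∣n+D | _ | _ = contradiction (∣m+n∣m⇒∣n y∣n+D y∣n) (>⇒∤ D<y)
  ... | no _ | yes 2z∣′ | _ = contradiction (∣m+n∣m⇒∣n 2z∣′ 2z∣) (>⇒∤ D<2z)
  ... | no _ | no _ | yes _ = cong (quotientParity y) (sym (m+n∸n≡m n D))
  ... | no _ | no _ | no y∤n = contradiction (subst (y ∣_) (sym (m+n∸n≡m n D)) y∣n) y∤n
  far-shift D<y n 2z∣ | no _ | no 2z∤ | _ = contradiction 2z∣ 2z∤
  far-shift D<y n 2z∣ | no y∤n | yes _ | _ with y ∣? (n + D) | (2 * z) ∣? (n + D + D) | y ∣? (n + D ∸ D)
  ... | yes _ | _ | _ = refl
  ... | no _ | yes 2z∣′ | _ = contradiction (∣m+n∣m⇒∣n 2z∣′ 2z∣) (>⇒∤ D<2z)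
  ... | no _ | no _ | yes y∣n = contradiction (subst (y ∣_) (m+n∸n≡m n D) y∣n) y∤n
  ... | no _ | no _ | no _ = refl

  -- The vertices n + x and n + z for n an odd multiple of z.
  End : ℕ → Set
  End n = 2 * z ∣ n ⊎ 2 * z ∣ n + D

  End? : ∀ n → Dec (End n)
  End? n = (2 * z) ∣? n ⊎-dec (2 * z) ∣? (n + D)

  choose : ∀ {P Q : Set} → Dec P → Dec Q → Parity → Parity
  choose (yes _) _       _ = 0ℙ
  choose (no _)  (yes _) _ = 1ℙ
  choose (no _)  (no _)  p = p

  -- For a positive multiple `n` of `y`, an odd quotient marks the lower end of a `y`-arc and an
  -- even one the upper end.
  partner : ℕ → ℕ
  partner n with quotientParity y n
  ... | 0ℙ = n ∸ y
  ... | 1ℙ = y + n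

  -- For y ≤ D a y-arc joins two vertices of End only if y ≡ D.
  near : ℕ → Parity
  near n = choose (End? n) (End? (partner n)) (quotientParity y n)

  near-End : ∀ n → End n → near n ≡ 0ℙ
  near-End n e with End? n
  ... | yes _ = refl
  ... | no ¬e = contradiction e ¬e

  near-shift : ∀ n → 2 * z ∣ n + D → near n ≡ near (n + D)
  near-shift n 2z∣ = trans (near-End n (inj₂ 2z∣)) (sym (near-End (n + D) (inj₁ 2z∣)))

  partner-lower : ∀ k → Odd k → partner (k * y) ≡ suc k * y
  partner-lower k ok rewrite quotientParity-* y k | ok = refl

  partner-upper : ∀ k → Odd k → partner (suc k * y) ≡ k * y
  partner-upper k ok rewrite quotientParity-* y (suc k) | odd⇒suc-even k ok = m+n∸m≡n y (k * y)

  -- Subtracting the two divisibilities makes `2 * z` divide `y`, `y + D` or `D - y`. All are below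
  -- `2 * z`, since `y ≤ D < z`, and only `D - y` can vanish.
  End-End : y ≤ D → ∀ u → End u → End (y + u) → y ≡ D × 2 * z ∣ y + u
  End-End y≤D u (inj₁ p) (inj₁ q) =
    contradiction (∣m+n∣m⇒∣n (subst (2 * z ∣_) (+-comm y u) q) p) (>⇒∤ (≤-<-trans y≤D D<2z))
  End-End y≤D u (inj₁ p) (inj₂ q) =
    contradiction (∣m+n∣m⇒∣n (subst (2 * z ∣_) (eq y u D) q) p) (>⇒∤ {{yD}} y+D<2z)
    where
    yD : NonZero (y + D)
    yD = >-nonZero (<-≤-trans (>-nonZero⁻¹ y) (m≤m+n y D))
    eq : ∀ y u D → y + u + D ≡ u + (y + D)
    eq = solve-∀
    y+D<2z : y + D < 2 * z
    y+D<2z = <-≤-trans (+-mono-< (≤-<-trans y≤D D<z) D<z) (≤-reflexive (cong (z +_) (sym (+-identityʳ z))))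
  End-End y≤D u (inj₂ p) (inj₁ q) with m≤n⇒m<n∨m≡n y≤D
  ... | inj₂ y≡D = y≡D , q
  ... | inj₁ y<D with d , refl ← m≤n⇒∃[o]m+o≡n y≤D =
    contradiction (∣m+n∣m⇒∣n (subst (2 * z ∣_) (eq u y d) p) q)
      (>⇒∤ {{d≢0}} (≤-<-trans (m≤n+m d y) D<2z))
    where
    d≢0 : NonZero d
    d≢0 = >-nonZero (+-cancelˡ-< y 0 d (subst (_< y + d) (sym (+-identityʳ y)) y<D))
    eq : ∀ u y d → u + (y + d) ≡ y + u + d
    eq = solve-∀
  End-End y≤D u (inj₂ p) (inj₂ q) =
    contradiction (∣m+n∣m⇒∣n (subst (2 * z ∣_) (eq y u D) q) p) (>⇒∤ (≤-<-trans y≤D D<2z))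
    where
    eq : ∀ y u D → y + u + D ≡ u + D + y
    eq = solve-∀

  -- If exactly one end lies in `End`, it has colour `0ℙ` and the other, as its partner, `1ℙ`. If
  -- neither does, the quotients decide. Two ends in `End` are the exception described by `End-End`.
  near-proper : y ≤ D → ∀ k → Odd k →
    near (suc k * y) ≡ near (k * y) ⁻¹ ⊎ (y ≡ D × 2 * z ∣ suc k * y)
  near-proper y≤D k ok rewrite partner-lower k ok | partner-upper k ok
    with End? (k * y) | End? (suc k * y)
  ... | yes e | yes e′ = inj₂ (End-End y≤D (k * y) e e′)
  ... | yes _ | no _  = inj₁ refl
  ... | no _  | yes _ = inj₁ refl
  ... | no _  | no _  = inj₁ (quotientParity-proper y k ok)

  -- Take `n = x + k * z`: then `n + D = suc k * z` is a multiple of `2 * z` for odd `k`, so `shift`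
  -- supplies the equality demanded by `extend-proper-odd`.
  extend-proper-z : (χ : ℕ → Parity) → Odd z → (∀ n → 2 * z ∣ n + D → χ n ≡ χ (n + D)) →
                    Proper (extend χ x) z
  extend-proper-z χ oz shift = extend-proper-odd χ x z oz λ k ok →
    trans (shift (x + k * z) (subst (2 * z ∣_) (eq x D (k * z)) (*-monoˡ-∣ z (2∣ (suc k) (odd⇒suc-even k ok)))))
          (cong χ (sym (eq x D (k * z))))
    where
    eq : ∀ x D kz → x + D + kz ≡ x + kz + D
    eq = solve-∀
    2∣ : ∀ n → Even n → 2 ∣ n
    2∣ n e with k , refl ← even⇒2* n e = m∣m*n k

  colourable-two-odd : Odd x → Even y → Odd z → y ≢ D → Colourable x y z
  colourable-two-odd ox ey oz y≢D with y ≤? D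
  ... | no y≰D = extend far x , extend-proper-self far x ox , extend-proper-even far x y ey far-proper
               , extend-proper-z far oz (far-shift (≰⇒> y≰D))
  ... | yes y≤D = extend near x , extend-proper-self near x ox
               , extend-proper-even near x y ey (λ k ok →
                   [ id , (λ q → contradiction (proj₁ q) y≢D) ]′ (near-proper y≤D k ok))
               , extend-proper-z near oz near-shift

colourable-oeo : ∀ x y z → .{{NonZero x}} → .{{NonZero y}} → x < z →
                 Odd x → Even y → Odd z → x + y ≢ z → Colourable x y z
colourable-oeo x y z x<z ox ey oz x+y≢z with D , refl ← m≤n⇒∃[o]m+o≡n (<⇒≤ x<z) =
  TwoOdd.colourable-two-odd x D y ox ey oz (x+y≢z ∘ cong (x +_))
  where
  instance
    D≢0 : NonZero D
    D≢0 = >-nonZero (+-cancelˡ-< x 0 D (subst (_< x + D) (sym (+-identityʳ x)) x<z))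

-- 2-adic valuations and the colouring in the general case.

-- After one halving, `ν₂ (2 * n)` evaluates `n` with fuel `2 * n - 1`, whereas `ν₂ n` uses fuel
-- `n`.
ν₂-go-fuel : ∀ f f′ n → n ≤ f → n ≤ f′ → ν₂-go f n ≡ ν₂-go f′ n
ν₂-go-fuel zero zero zero _ _ = refl
ν₂-go-fuel zero (suc f′) zero _ _ = refl
ν₂-go-fuel (suc f) zero zero _ _ = refl
ν₂-go-fuel (suc f) (suc f′) zero _ _ = refl
ν₂-go-fuel (suc f) (suc f′) (suc m) (s≤s p) (s≤s q) with suc m % 2 ≟ 0
... | no _ = refl
... | yes _ = cong suc (ν₂-go-fuel f f′ (suc m / 2) (≤-trans half p) (≤-trans half q))
  where
  half : suc m / 2 ≤ m
  half = s≤s⁻¹ (m/n<m (suc m) 2 ≤-refl)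

ν₂-double : ∀ n → .{{NonZero n}} → ν₂ (2 * n) ≡ suc (ν₂ n)
ν₂-double n@(suc n′) with 2 * n % 2 ≟ 0
... | no ≢0 = contradiction (trans (cong (_% 2) (*-comm 2 n)) (m*n%n≡0 n 2)) ≢0
... | yes _ = cong suc (trans (cong (ν₂-go (n′ + suc (n′ + 0))) 2n/2≡n)
                              (ν₂-go-fuel _ n n n≤ ≤-refl))
  where
  2n/2≡n : 2 * n / 2 ≡ n
  2n/2≡n = trans (cong (_/ 2) (*-comm 2 n)) (m*n/n≡m n 2)
  n≤ : n ≤ n′ + suc (n′ + 0)
  n≤ = ≤-trans (≤-reflexive (cong suc (sym (+-identityʳ n′)))) (m≤n+m _ n′)

parity-% : ∀ n → n % 2 ≡ 1 → Odd n
parity-% n eq with even-or-odd n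
... | inj₂ o = o
... | inj₁ e with k , refl ← even⇒2* n e
             with () ← trans (sym (trans (cong (_% 2) (*-comm 2 k)) (m*n%n≡0 k 2))) eq

ν₂-odd : ∀ n → Odd n → ν₂ n ≡ 0
ν₂-odd (suc n) o with suc n % 2 ≟ 0
... | no _ = refl
... | yes eq with divides q eq′ ← m%n≡0⇒n∣m (suc n) 2 eq =
  contradiction o (¬even×odd (suc n) (trans (cong parity eq′) (*-evenʳ q 2 refl)))

ν₂-even : ∀ n → .{{NonZero n}} → Even n → ν₂ n ≢ 0
ν₂-even n e eq with even⇒2* n e
... | suc k , refl with () ← trans (sym (ν₂-double (suc k))) eq

-- The even element `c` exceeds both odd ones, so it cannot be their difference.
colourable-ooe : ∀ a b c → .{{NonZero a}} → .{{NonZero b}} → .{{NonZero c}} →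
                 a ≢ b → a < c → b < c → Odd a → Odd b → Even c → Colourable a b c
colourable-ooe a b c a≢b a<c b<c oa ob ec with <-cmp a b
... | tri< a<b _ _ = rotate (swap₁₂ (colourable-oeo a c b a<b oa ec ob λ { refl → <⇒≱ b<c (m≤n+m c a) }))
... | tri≈ _ a≡b _ = contradiction a≡b a≢b
... | tri> _ _ b<a = rotate (rotate (colourable-oeo b c a b<a ob ec oa λ { refl → <⇒≱ a<c (m≤n+m c b) }))

-- When exactly one of `a` and `b` is even and `c` is odd, the valuations differ, so the hypothesis
-- excludes `a + b ≡ c`. When all three are even, halving them preserves the hypothesis.
colourable : ∀ a b c → 0 < a → 0 < b → a ≢ b → a < c → b < c →
             ¬ (a + b ≡ c × ν₂ a ≢ ν₂ b) → Colourable a b c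
colourable a = go a a ≤-refl
  where
  go : ∀ f a → a ≤ f → ∀ b c → 0 < a → 0 < b → a ≢ b → a < c → b < c →
       ¬ (a + b ≡ c × ν₂ a ≢ ν₂ b) → Colourable a b c
  go zero a@(suc _) () b c 0<a 0<b a≢b a<c b<c ¬forcing
  go (suc f) a@(suc _) a≤1+f b@(suc _) c@(suc _) 0<a 0<b a≢b a<c b<c ¬forcing
    with even-or-odd a | even-or-odd b | even-or-odd c
  ... | inj₁ ea | inj₁ eb | inj₂ oc = colourable-eeo a b c 0<a 0<b ea eb oc
  ... | inj₁ ea | inj₂ ob | inj₁ ec = rotate (colourable-eeo c a b (≤-<-trans z≤n a<c) 0<a ec ea ob)
  ... | inj₂ oa | inj₁ eb | inj₁ ec = rotate (rotate (colourable-eeo b c a 0<b (≤-<-trans z≤n a<c) eb ec oa))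
  ... | inj₂ oa | inj₂ ob | inj₂ oc = colourable-ooo a b c oa ob oc
  ... | inj₁ ea | inj₂ ob | inj₂ oc =
    swap₁₂ (colourable-oeo b a c b<c ob ea oc λ eq →
      ¬forcing (trans (+-comm a b) eq , λ ν≡ → ν₂-even a ea (trans ν≡ (ν₂-odd b ob))))
  ... | inj₂ oa | inj₁ eb | inj₂ oc =
    colourable-oeo a b c a<c oa eb oc λ eq →
      ¬forcing (eq , λ ν≡ → ν₂-even b eb (trans (sym ν≡) (ν₂-odd a oa)))
  ... | inj₂ oa | inj₂ ob | inj₁ ec = colourable-ooe a b c a≢b a<c b<c oa ob ec
  ... | inj₁ ea | inj₁ eb | inj₁ ec with even⇒2* a ea | even⇒2* b eb | even⇒2* c ec
  ... | a′@(suc _) , refl | b′@(suc _) , refl | c′@(suc _) , refl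
    with χ , p , q , r ← go f a′ (half≤ a′ a≤1+f) b′ c′ (s≤s z≤n) (s≤s z≤n)
           (λ eq → a≢b (cong (2 *_) eq)) (*-cancelˡ-< 2 a′ c′ a<c) (*-cancelˡ-< 2 b′ c′ b<c)
           (λ (sum , ν≢) → ¬forcing (trans (sym (*-distribˡ-+ 2 a′ b′)) (cong (2 *_) sum) ,
              λ eq → ν≢ (suc-injective (trans (sym (ν₂-double a′)) (trans eq (ν₂-double b′)))))) =
    (λ n → χ (n / 2)) , proper-double χ a′ p , proper-double χ b′ q , proper-double χ c′ r

-- Colourings and sign sequences.

sign : Parity → ℤ
sign 0ℙ = ℤ.+ 1
sign 1ℙ = ℤ.- (ℤ.+ 1)

-- The terms with indices `k` and `suc k` cancel for each odd `k`.
proper⇒partialSum-even : ∀ χ s → Proper χ s → ∀ k → Even k → partialSum (sign ∘ χ) s k ≡ ℤ.+ 0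
proper⇒partialSum-even χ s p zero e = refl
proper⇒partialSum-even χ s p (suc (suc k)) e
  rewrite proper⇒partialSum-even χ s p k e | p (suc k) (even⇒suc-odd k e)
  with χ (suc k * s)
... | 0ℙ = refl
... | 1ℙ = refl

proper⇒partialSum≤1 : ∀ χ s → Proper χ s → ∀ k → ℤ.∣ partialSum (sign ∘ χ) s k ∣ ≤ 1
proper⇒partialSum≤1 χ s p zero = z≤n
proper⇒partialSum≤1 χ s p (suc k) with even-or-odd k
... | inj₂ o rewrite proper⇒partialSum-even χ s p (suc k) (odd⇒suc-even k o) = z≤n
... | inj₁ e rewrite proper⇒partialSum-even χ s p k e with χ (suc k * s)
...   | 0ℙ = ≤-refl
...   | 1ℙ = ≤-refl

colourable⇒¬forces : ∀ a b c → Colourable a b c → ¬ ForcesDisc2 (a ∷ b ∷ c ∷ [])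
colourable⇒¬forces a b c (χ , p , q , r) forces with forces (sign ∘ χ) isSign
  where
  isSign : IsSignSeq (sign ∘ χ)
  isSign n with χ n
  ... | 0ℙ = inj₁ refl
  ... | 1ℙ = inj₂ refl
... | s , k , here refl , _ , 1<                 = <⇒≱ 1< (proper⇒partialSum≤1 χ s p k)
... | s , k , there (here refl) , _ , 1<         = <⇒≱ 1< (proper⇒partialSum≤1 χ s q k)
... | s , k , there (there (here refl)) , _ , 1< = <⇒≱ 1< (proper⇒partialSum≤1 χ s r k)

Violation : (ℕ → ℤ) → List ℕ → Set
Violation x S = Σ ℕ λ s → Σ ℕ λ k → s ∈ S × 1 ≤ k × 1 < ℤ.∣ partialSum x s k ∣

colour : ∀ {x} → IsSignSeq x → ℕ → Parity
colour isSign n with isSign n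
... | inj₁ _ = 0ℙ
... | inj₂ _ = 1ℙ

-- Starting from sum 0, two equal signs give 2 or -2, which is a violation; two opposite signs
-- return the sum to 0.
partialSum-step : ∀ {x S s} (isSign : IsSignSeq x) → s ∈ S → ∀ k → partialSum x s k ≡ ℤ.+ 0 →
  Violation x S ⊎
  (colour isSign (suc (suc k) * s) ≡ colour isSign (suc k * s) ⁻¹ × partialSum x s (suc (suc k)) ≡ ℤ.+ 0)
partialSum-step {x} {S} {s} isSign s∈S k eq = go
  where
  sum≡ : ∀ {m n} → x (suc k * s) ≡ m → x (suc (suc k) * s) ≡ n →
         partialSum x s (suc (suc k)) ≡ ℤ.+ 0 ℤ.+ m ℤ.+ n
  sum≡ p q = cong₂ ℤ._+_ (cong₂ ℤ._+_ eq p) q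
  violation : ∀ {m n} → x (suc k * s) ≡ m → x (suc (suc k) * s) ≡ n →
              1 < ℤ.∣ ℤ.+ 0 ℤ.+ m ℤ.+ n ∣ → Violation x S
  violation p q 1< = s , suc (suc k) , s∈S , s≤s z≤n , subst (λ t → 1 < ℤ.∣ t ∣) (sym (sum≡ p q)) 1<
  go : Violation x S ⊎
    (colour isSign (suc (suc k) * s) ≡ colour isSign (suc k * s) ⁻¹ × partialSum x s (suc (suc k)) ≡ ℤ.+ 0)
  go with isSign (suc k * s) | isSign (suc (suc k) * s)
  ... | inj₁ p | inj₁ q = inj₁ (violation p q ≤-refl)
  ... | inj₁ p | inj₂ q = inj₂ (refl , sum≡ p q)
  ... | inj₂ p | inj₁ q = inj₂ (refl , sum≡ p q)
  ... | inj₂ p | inj₂ q = inj₁ (violation p q ≤-refl)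

partialSum-even : ∀ {x S s} → IsSignSeq x → s ∈ S → ∀ k → Even k →
                  Violation x S ⊎ partialSum x s k ≡ ℤ.+ 0
partialSum-even isSign s∈S zero e = inj₂ refl
partialSum-even isSign s∈S (suc (suc k)) e with partialSum-even isSign s∈S k e
... | inj₁ v = inj₁ v
... | inj₂ eq = Sum.map₂ proj₂ (partialSum-step isSign s∈S k eq)

violation-or-proper : ∀ {x S s} (isSign : IsSignSeq x) → s ∈ S → ∀ k → Odd k →
                      Violation x S ⊎ colour isSign (suc k * s) ≡ colour isSign (k * s) ⁻¹
violation-or-proper isSign s∈S (suc k) o with even-or-odd k
... | inj₂ o′ = contradiction o (¬even×odd (suc k) (odd⇒suc-even k o′))
... | inj₁ e with partialSum-even isSign s∈S k e
...   | inj₁ v = inj₁ v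
...   | inj₂ eq = Sum.map₂ proj₁ (partialSum-step isSign s∈S k eq)

-- Odd closed walks and the reflection of G(S) into G′(S).

-- `Q` is what a step yields when it fails to flip the colour. If every step flips it, an odd number
-- of steps ends in the wrong colour. `Q` will be a discrepancy violation or the claim `L ≡ 3`.
odd-closed-walk : ∀ {Q : Set} (c : ℕ → Parity) L →
  (∀ i → i < L → Q ⊎ c (suc i) ≡ c i ⁻¹) → Odd L → c L ≡ c 0 → Q
odd-closed-walk {Q} c L step oL closed with walk L ≤-refl
  where
  walk : ∀ n → n ≤ L → Q ⊎ c n ≡ parity n ℙ.+ c 0
  walk zero _ = inj₂ refl
  walk (suc n) n<L with step n n<L | walk n (<⇒≤ n<L)
  ... | inj₁ q | _ = inj₁ q
  ... | inj₂ _ | inj₁ q = inj₁ q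
  ... | inj₂ eq | inj₂ eq′ = inj₂ (trans eq (trans (cong _⁻¹ eq′)
          (trans (lem (parity n) (c 0)) (cong (ℙ._+ c 0) (sym (parity-suc n))))))
    where
    lem : ∀ p q → (p ℙ.+ q) ⁻¹ ≡ p ⁻¹ ℙ.+ q
    lem 0ℙ q = refl
    lem 1ℙ q = ⁻¹-involutive q
... | inj₁ q = q
... | inj₂ eq = contradiction (trans (sym closed) (trans eq (cong (ℙ._+ c 0) oL))) (p≢p⁻¹ (c 0))

-- Arc and Adj′ describe G′(S).
Arc : ℕ → ℕ → ℕ → Set
Arc s u v = ∃ λ k → Odd k × u ≡ k * s × v ≡ suc k * s

Adj′ : List ℕ → ℕ → ℕ → Set
Adj′ S u v = ∃ λ s → s ∈ S × (Arc s u v ⊎ Arc s v u)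

Adj′-sym : ∀ {S u v} → Adj′ S u v → Adj′ S v u
Adj′-sym (s , s∈S , arc) = s , s∈S , Sum.swap arc

-- With `P = q * s`, the multiples `2 * j` and `2 * j + 1` of `s` become `2 * q - 2 * j` and
-- `2 * q - 2 * j - 1`. The second is odd, so the arc is turned upside down.
reflect-arc : ∀ {s P} j → s ∣ P → (2 * j + 1) * s ≤ 2 * P →
              Arc s (2 * P ∸ (2 * j + 1) * s) (2 * P ∸ 2 * j * s)
-- Here both ends are 0, and 1 serves as the odd multiplier.
reflect-arc {zero} {P} j s∣P le with refl ← 0∣⇒≡0 s∣P =
  1 , refl , 0∸n≡0 ((2 * j + 1) * 0) , 0∸n≡0 (2 * j * 0)
reflect-arc {s@(suc _)} j (divides q refl) le =
  suc (2 * d) , even⇒suc-odd (2 * d) (*-evenˡ 2 d refl) , lower , upper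
  where
  j<q : j < q
  j<q = *-cancelˡ-< 2 j q (*-cancelʳ-≤ _ _ s (≤-trans (≤-reflexive (cong (_* s) (+-comm 1 (2 * j))))
          (≤-trans le (≤-reflexive (sym (*-assoc 2 q s))))))
  d : ℕ
  d = q ∸ suc j
  eq : suc j + d ≡ q
  eq = m+[n∸m]≡n j<q
  lower : 2 * (q * s) ∸ (2 * j + 1) * s ≡ suc (2 * d) * s
  lower = trans (cong (λ r → 2 * (r * s) ∸ (2 * j + 1) * s) (sym eq))
                (trans (cong (_∸ (2 * j + 1) * s) (ring j d s)) (m+n∸m≡n ((2 * j + 1) * s) _))
    where
    ring : ∀ j d s → 2 * ((suc j + d) * s) ≡ (2 * j + 1) * s + suc (2 * d) * s
    ring = solve-∀
  upper : 2 * (q * s) ∸ 2 * j * s ≡ suc (suc (2 * d)) * s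
  upper = trans (cong (λ r → 2 * (r * s) ∸ 2 * j * s) (sym eq))
                (trans (cong (_∸ 2 * j * s) (ring j d s)) (m+n∸m≡n (2 * j * s) _))
    where
    ring : ∀ j d s → 2 * ((suc j + d) * s) ≡ 2 * j * s + suc (suc (2 * d)) * s
    ring = solve-∀

reflect : ∀ {S P u v} → (∀ {s} → s ∈ S → s ∣ P) → u ≤ 2 * P → v ≤ 2 * P →
          Adj S u v → Adj′ S (2 * P ∸ u) (2 * P ∸ v)
reflect s∣P u≤ v≤ (s , j , s∈S , inj₁ (refl , refl)) = s , s∈S , inj₂ (reflect-arc j (s∣P s∈S) v≤)
reflect s∣P u≤ v≤ (s , j , s∈S , inj₂ (refl , refl)) = s , s∈S , inj₁ (reflect-arc j (s∣P s∈S) u≤)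

bounded : ∀ (f : ℕ → ℕ) n → ∃ λ B → ∀ i → i ≤ n → f i ≤ B
bounded f zero = f 0 , λ { zero z≤n → ≤-refl }
bounded f (suc n) with B , le ← bounded f n = B + f (suc n) , λ i i≤ → go i (m≤n⇒m<n∨m≡n i≤)
  where
  go : ∀ i → i < suc n ⊎ i ≡ suc n → f i ≤ B + f (suc n)
  go i (inj₁ (s≤s i≤n)) = ≤-trans (le i i≤n) (m≤m+n B _)
  go i (inj₂ refl) = m≤n+m _ B

-- The product of `S` gives the divisibility; the bound on `f` makes the truncated subtractions from
-- `2 * P` exact.
reflection : ∀ S → All NonZero S → ∀ (f : ℕ → ℕ) n →
             ∃ λ P → (∀ {s} → s ∈ S → s ∣ P) × (∀ i → i ≤ n → f i ≤ 2 * P)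
reflection S pos f n with B , f≤B ← bounded f n =
  product S * B , (λ s∈S → ∣m⇒∣m*n B (∈⇒∣product s∈S)) ,
  λ i i≤n → ≤-trans (f≤B i i≤n) (≤-trans (m≤n*m B (product S) {{product≢0 pos}}) (m≤m+n _ _))

-- Reflection turns the cycle into an odd closed walk in G′(S). A sequence without violation would
-- flip its sign along every edge of that walk.
odd-cycle⇒forces : ∀ {S L} → All NonZero S → HasCycle S L → Odd L → ForcesDisc2 S
odd-cycle⇒forces {S} {L} pos (f , _ , _ , adj , closed) oL x isSign
  with P , s∣P , f≤ ← reflection S pos f L =
  odd-closed-walk (λ i → colour isSign (2 * P ∸ f i)) L step oL (cong (λ n → colour isSign (2 * P ∸ n)) closed)
  where
  edge : ∀ {u v} → Adj′ S u v → Violation x S ⊎ colour isSign v ≡ colour isSign u ⁻¹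
  edge (s , s∈S , inj₁ (k , ok , refl , refl)) = violation-or-proper isSign s∈S k ok
  edge (s , s∈S , inj₂ (k , ok , refl , refl)) =
    Sum.map₂ (λ eq → sym (trans (cong _⁻¹ eq) (⁻¹-involutive _))) (violation-or-proper isSign s∈S k ok)
  step : ∀ i → i < L → _ ⊎ _
  step i i<L = edge (reflect s∣P (f≤ i (<⇒≤ i<L)) (f≤ (suc i) i<L) (adj i i<L))

-- Existence of the triangle.

coprime-inverse : ∀ m n → Coprime m n → Even n → ∃ λ k → ∃ λ q → m * k ≡ 1 + n * q
coprime-inverse m n coprime en with coprime-Bézout coprime
... | Bézout.+- k q eq = k , q , trans (*-comm m k) (trans (sym eq) (cong suc (*-comm q n)))
-- With coefficient 0, Bézout's identity would make 1 a multiple of the even `n`.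
... | Bézout.-+ zero q eq = contradiction (trans (cong parity eq) (*-evenʳ q n en)) λ ()
-- m k ≡ − 1 (mod n) gives m (k (m k)) ≡ 1 (mod n).
... | Bézout.-+ k@(suc _) q eq with m * k in eqN
...   | zero = contradiction
    (trans (cong parity (trans (cong suc (trans (sym eqN) (*-comm m k))) eq)) (*-evenʳ q n en)) λ ()
...   | suc N = k * suc N , q * N , (begin
    m * (k * suc N)     ≡⟨ *-assoc m k (suc N) ⟨
    m * k * suc N       ≡⟨ cong (_* suc N) eqN ⟩
    suc N * suc N       ≡⟨ square N ⟩
    1 + suc (suc N) * N ≡⟨ cong (λ M → 1 + M * N) (trans (cong suc (trans (sym eqN) (*-comm m k))) eq) ⟩
    1 + q * n * N       ≡⟨ cong suc (rearrange q n N) ⟩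
    1 + n * (q * N)     ∎)
  where
  open ≡-Reasoning
  square : ∀ N → suc N * suc N ≡ 1 + suc (suc N) * N
  square = solve-∀
  rearrange : ∀ q n N → q * n * N ≡ n * (q * N)
  rearrange = solve-∀

-- A common divisor of `m` and `2 * n` is odd because `m` is, hence coprime to 2, and so divides
-- `n`.
odd-coprime-2* : ∀ m n → Odd m → Coprime m n → Coprime m (2 * n)
odd-coprime-2* m n om coprime {d} (divides q refl , d∣2n) =
  coprime (divides q refl , coprime-divisor d-coprime-2 d∣2n)
  where
  d-coprime-2 : Coprime d 2
  d-coprime-2 {e} (e∣d , e∣2) with e in eq
  ... | 0 = contradiction (0∣⇒≡0 e∣2) λ ()
  ... | 1 = refl
  ... | suc (suc (suc _)) = contradiction e∣2 (>⇒∤ (s≤s (s≤s (s≤s z≤n))))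
  ... | 2 with divides r refl ← e∣d = contradiction (odd*⇒oddʳ q (r * 2) om) (¬even×odd (r * 2) (*-evenʳ r 2 refl))

triangle⇒cycle : ∀ {S u v w} → u ≢ v → v ≢ w → w ≢ u → Adj S u v → Adj S v w → Adj S w u → HasCycle S 3
triangle⇒cycle {S} {u} {v} {w} u≢v v≢w w≢u uv vw wu = f , ≤-refl , inj , adj , refl
  where
  f : ℕ → ℕ
  f 0 = u
  f 1 = v
  f 2 = w
  f _ = u
  inj : ∀ i j → i < 3 → j < 3 → f i ≡ f j → i ≡ j
  inj 0 0 _ _ _ = refl
  inj 0 1 _ _ eq = contradiction eq u≢v
  inj 0 2 _ _ eq = contradiction (sym eq) w≢u
  inj 1 0 _ _ eq = contradiction (sym eq) u≢v
  inj 1 1 _ _ _ = refl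
  inj 1 2 _ _ eq = contradiction eq v≢w
  inj 2 0 _ _ eq = contradiction eq w≢u
  inj 2 1 _ _ eq = contradiction (sym eq) v≢w
  inj 2 2 _ _ _ = refl
  inj (suc (suc (suc i))) j (s≤s (s≤s (s≤s ()))) _ _
  inj 0 (suc (suc (suc i))) _ (s≤s (s≤s (s≤s ()))) _
  inj 1 (suc (suc (suc i))) _ (s≤s (s≤s (s≤s ()))) _
  inj 2 (suc (suc (suc i))) _ (s≤s (s≤s (s≤s ()))) _
  adj : ∀ i → i < 3 → Adj S (f i) (f (suc i))
  adj 0 _ = uv
  adj 1 _ = vw
  adj 2 _ = wu
  adj (suc (suc (suc i))) (s≤s (s≤s (s≤s ())))

-- The triangle is W, W + q g, W + (p + q) g for W = (p + q) g (p k − 1), where p k ≡ 1 (mod 2 q).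
three-cycle-coprime : ∀ p q g → .{{NonZero p}} → .{{NonZero q}} → .{{NonZero g}} →
  Odd p → Even q → Coprime p q → HasCycle (p * g ∷ q * g ∷ p * g + q * g ∷ []) 3
three-cycle-coprime p q g op eq coprime
  with coprime-inverse p (2 * q) (odd-coprime-2* p q op coprime) (*-evenˡ 2 q refl)
-- The top vertex is `(p + q) * g * (p * k)`, which is `(p + q) * k` times `p * g`. This multiplier
-- must be odd for a `p * g`-arc to lead there from `V`.
... | k , r , pk≡ with odd⇒1+2* ((p + q) * k) (*-odd-odd (p + q) k (+-odd-even p q op eq) ok)
  where
  ok : Odd k
  ok = odd*⇒oddʳ p k (trans (cong parity pk≡) (even⇒suc-odd (2 * q * r) (*-evenˡ (2 * q) r (*-evenˡ 2 q refl))))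
... | l , [p+q]k≡ = triangle⇒cycle (<⇒≢ W<V) (<⇒≢ V<U) (<⇒≢ (<-trans W<V V<U) ∘ sym)
  (q * g , (p + q) * r , there (here refl) , inj₁ (refl , refl))
  (p * g , l , here refl , inj₁ (V≡ , U≡))
  (p * g + q * g , q * r , there (there (here refl)) , inj₂ (W≡ p q g r , refl))
  where
  W V U : ℕ
  W = 2 * ((p + q) * r) * (q * g)
  V = (2 * ((p + q) * r) + 1) * (q * g)
  U = (2 * (q * r) + 1) * (p * g + q * g)
  W≡ : ∀ p q g r → 2 * ((p + q) * r) * (q * g) ≡ 2 * (q * r) * (p * g + q * g)
  W≡ = solve-∀
  V+x≡U : ∀ p q g r → (2 * ((p + q) * r) + 1) * (q * g) + p * g ≡ (2 * (q * r) + 1) * (p * g + q * g)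
  V+x≡U = solve-∀
  instance
    _ = m*n≢0 p g
    _ = m*n≢0 q g
  W<V : W < V
  W<V = *-monoˡ-< (q * g) (m<m+n (2 * ((p + q) * r)) {1} (s≤s z≤n))
  V<U : V < U
  V<U = subst (V <_) (V+x≡U p q g r) (m<m+n V (>-nonZero⁻¹ (p * g)))
  U≡ : U ≡ (2 * l + 1) * (p * g)
  U≡ = begin
    (2 * (q * r) + 1) * (p * g + q * g) ≡⟨ ring₁ p q g r ⟩
    (1 + 2 * q * r) * ((p + q) * g)     ≡⟨ cong (_* ((p + q) * g)) pk≡ ⟨
    p * k * ((p + q) * g)               ≡⟨ ring₂ p q g k ⟩
    (p + q) * k * (p * g)               ≡⟨ cong (_* (p * g)) (trans [p+q]k≡ (+-comm 1 (2 * l))) ⟩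
    (2 * l + 1) * (p * g)               ∎
    where
    open ≡-Reasoning
    ring₁ : ∀ p q g r → (2 * (q * r) + 1) * (p * g + q * g) ≡ (1 + 2 * q * r) * ((p + q) * g)
    ring₁ = solve-∀
    ring₂ : ∀ p q g k → p * k * ((p + q) * g) ≡ (p + q) * k * (p * g)
    ring₂ = solve-∀
  V≡ : V ≡ 2 * l * (p * g)
  V≡ = +-cancelʳ-≡ (p * g) V (2 * l * (p * g))
    (trans (V+x≡U p q g r) (trans U≡ (ring (2 * l) (p * g))))
    where
    ring : ∀ m s → (m + 1) * s ≡ m * s + s
    ring = solve-∀

-- The gcd is odd because it divides `x`, so dividing by it keeps the parities and makes the pair
-- coprime.
three-cycle : ∀ x y → .{{NonZero x}} → .{{NonZero y}} → Odd x → Even y →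
              HasCycle (x ∷ y ∷ x + y ∷ []) 3
three-cycle x y ox ey =
  subst₂ (λ x y → HasCycle (x ∷ y ∷ x + y ∷ []) 3) x≡ y≡
    (three-cycle-coprime (x / g) (y / g) g {{nz x (gcd[m,n]∣m x y)}} {{nz y (gcd[m,n]∣n x y)}}
      op eq (coprime-/gcd x y))
  where
  g = gcd x y
  instance
    g≢0 : NonZero g
    g≢0 = ≢-nonZero (gcd[m,n]≢0 x y (inj₁ (≢-nonZero⁻¹ x)))
  x≡ : x / g * g ≡ x
  x≡ = m/n*n≡m (gcd[m,n]∣m x y)
  y≡ : y / g * g ≡ y
  y≡ = m/n*n≡m (gcd[m,n]∣n x y)
  nz : ∀ m → .{{NonZero m}} → g ∣ m → NonZero (m / g)
  nz m g∣m = >-nonZero (m≥n⇒m/n>0 (∣⇒≤ g∣m))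
  odd-x : Odd (x / g * g)
  odd-x = trans (cong parity x≡) ox
  op : Odd (x / g)
  op = odd*⇒oddˡ (x / g) g odd-x
  eq : Even (y / g)
  eq with even-or-odd (y / g)
  ... | inj₁ e = e
  ... | inj₂ o = contradiction (sym y≡) (even≢odd*odd (y / g) g ey o (odd*⇒oddʳ (x / g) g odd-x))

-- Odd cycles when the even element is the difference of the odd ones.

%-≡⇒∣ : ∀ b j L .{{_ : NonZero L}} → b % L ≡ (b + j) % L → L ∣ j
%-≡⇒∣ b j L eq = ∣m+n∣m⇒∣n (divides ((b + j) / L) lem) (n∣m*n (b / L))
  where
  open ≡-Reasoning
  lem : b / L * L + j ≡ (b + j) / L * L
  lem = +-cancelˡ-≡ (b % L) _ _ (begin
    b % L + (b / L * L + j)           ≡⟨ +-assoc (b % L) (b / L * L) j ⟨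
    b % L + b / L * L + j             ≡⟨ cong (_+ j) (m≡m%n+[m/n]*n b L) ⟨
    b + j                             ≡⟨ m≡m%n+[m/n]*n (b + j) L ⟩
    (b + j) % L + (b + j) / L * L     ≡⟨ cong (_+ (b + j) / L * L) eq ⟨
    b % L + (b + j) / L * L           ∎)

-- Lets the cycle be walked round indefinitely with indices modulo `L`; `f L ≡ f 0` bridges the step
-- from `L - 1` to 0.
cyclic-step : ∀ (f : ℕ → ℕ) L .{{_ : NonZero L}} → f L ≡ f 0 → ∀ i → f (suc i % L) ≡ f (suc (i % L))
cyclic-step f L closed i = trans (cong f suc-%) (wrap (m≤n⇒m<n∨m≡n (m%n<n i L)))
  where
  suc-% : suc i % L ≡ suc (i % L) % L
  suc-% = trans (cong (λ n → suc n % L) (m≡m%n+[m/n]*n i L)) ([m+kn]%n≡m%n (suc (i % L)) (i / L) L)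
  wrap : ∀ {r} → r < L ⊎ r ≡ L → f (r % L) ≡ f r
  wrap (inj₁ r<L) = cong f (m<n⇒m%n≡m r<L)
  wrap (inj₂ refl) = trans (cong f (n%n≡0 L)) (sym closed)

module NoLongOddCycle (x y : ℕ) .{{_ : NonZero x}} .{{_ : NonZero y}} (ox : Odd x) (ey : Even y) where

  -- In this case, `D = y`, the colouring `near` can fail only at the arcs called `Bad` below.
  open TwoOdd x y y

  S : List ℕ
  S = x ∷ y ∷ z ∷ []

  oz : Odd z
  oz = +-odd-even x y ox ey

  instance
    z≢0 : NonZero z
    z≢0 = >-nonZero (<-≤-trans (>-nonZero⁻¹ x) (m≤m+n x y))

  z∤x : z ∤ x
  z∤x = >⇒∤ (m<m+n x (>-nonZero⁻¹ y))

  z∤y : z ∤ y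
  z∤y = >⇒∤ (m<n+m y (>-nonZero⁻¹ x))

  χ : ℕ → Parity
  χ = extend near x

  Bad : ℕ → ℕ → Set
  Bad u v = Arc y u v × 2 * z ∣ v

  arc-colour : ∀ {s u v} → s ∈ S → Arc s u v → Bad u v ⊎ χ v ≡ χ u ⁻¹
  arc-colour (here refl) (k , ok , refl , refl) = inj₂ (extend-proper-self near x ox k ok)
  arc-colour (there (here refl)) (k , ok , refl , refl)
    rewrite extend-even near x (k * y) (*-evenʳ k y ey)
          | extend-even near x (suc k * y) (*-evenʳ (suc k) y ey) with near-proper ≤-refl k ok
  ... | inj₁ eq = inj₂ eq
  ... | inj₂ (_ , 2z∣v) = inj₁ ((k , ok , refl , refl) , 2z∣v)
  arc-colour (there (there (here refl))) (k , ok , refl , refl) =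
    inj₂ (extend-proper-z near oz near-shift k ok)

  edge-colour : ∀ {u v} → Adj′ S u v → (Bad u v ⊎ Bad v u) ⊎ χ v ≡ χ u ⁻¹
  edge-colour (s , s∈S , inj₁ arc) = Sum.map₁ inj₁ (arc-colour s∈S arc)
  edge-colour (s , s∈S , inj₂ arc) =
    Sum.map inj₂ (λ eq → sym (trans (cong _⁻¹ eq) (⁻¹-involutive _))) (arc-colour s∈S arc)

  -- Since `u` is even, it can only be the upper end of an `x`- or `z`-arc. It is no multiple of
  -- `z`, because `z` divides `v = y + u` but not `y`. Its only `y`-arc leads to `v`.
  lower-neighbour : ∀ {u v w} → Bad u v → Adj′ S u w → w ≢ v → w + x ≡ u
  lower-neighbour {u} {v} {w} ((k , ok , refl , refl) , 2z∣v) = go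
    where
    eu : Even (k * y)
    eu = *-evenʳ k y ey
    go : Adj′ S (k * y) w → w ≢ suc k * y → w + x ≡ k * y
    go (_ , here refl , inj₁ (k′ , ok′ , eq , _)) _ = contradiction eq (even≢odd*odd k′ x eu ok′ ox)
    go (_ , here refl , inj₂ (k′ , _ , refl , eq)) _ = trans (+-comm (k′ * x) x) (sym eq)
    go (_ , there (here refl) , inj₁ (k′ , _ , eq , refl)) w≢v = contradiction (cong (y +_) (sym eq)) w≢v
    go (_ , there (here refl) , inj₂ (k′ , ok′ , _ , eq)) _ =
      contradiction ok (¬even×odd k (trans (cong parity (*-cancelʳ-≡ k (suc k′) y eq)) (odd⇒suc-even k′ ok′)))
    go (_ , there (there (here refl)) , inj₁ (k′ , ok′ , eq , _)) _ =
      contradiction eq (even≢odd*odd k′ z eu ok′ oz)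
    go (_ , there (there (here refl)) , inj₂ (k′ , _ , _ , eq)) _ =
      contradiction (∣m+n∣m⇒∣n (subst (z ∣_) (+-comm y (k * y)) (m*n∣⇒n∣ 2 z 2z∣v)) (divides (suc k′) eq)) z∤y

  -- As `v` is even, `x`- and `z`-arcs reach it only from below, and its only `y`-arc leads to `u`.
  upper-neighbour : ∀ {u v w} → Bad u v → Adj′ S v w → w ≢ u → w + z ≡ v ⊎ w + x ≡ v
  upper-neighbour {u} {v} {w} ((k , ok , refl , refl) , 2z∣v) = go
    where
    ev : Even (suc k * y)
    ev = *-evenʳ (suc k) y ey
    go : Adj′ S (suc k * y) w → w ≢ k * y → w + z ≡ suc k * y ⊎ w + x ≡ suc k * y
    go (_ , here refl , inj₁ (k′ , ok′ , eq , _)) _ = contradiction eq (even≢odd*odd k′ x ev ok′ ox)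
    go (_ , here refl , inj₂ (k′ , _ , refl , eq)) _ = inj₂ (trans (+-comm (k′ * x) x) (sym eq))
    go (_ , there (here refl) , inj₁ (k′ , ok′ , eq , _)) _ =
      contradiction (trans (cong parity (*-cancelʳ-≡ (suc k) k′ y eq)) ok′) (¬even×odd (suc k) (odd⇒suc-even k ok))
    go (_ , there (here refl) , inj₂ (k′ , _ , refl , eq)) w≢u = contradiction (+-cancelˡ-≡ y _ _ (sym eq)) w≢u
    go (_ , there (there (here refl)) , inj₁ (k′ , ok′ , eq , _)) _ =
      contradiction eq (even≢odd*odd k′ z ev ok′ oz)
    go (_ , there (there (here refl)) , inj₂ (k′ , _ , refl , eq)) _ = inj₁ (trans (+-comm (k′ * z) z) (sym eq))

  -- Being odd, `p` lies on no `y`-arc and is the upper end of no `x`-arc. It is no multiple of `z`,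
  -- because `z` divides `v = p + x` but not `x`.
  pendant : ∀ {u v p w} → Bad u v → p + x ≡ v → Adj′ S p w → w ≡ v
  pendant {p = p} {w} ((k , ok , refl , refl) , 2z∣v) p+x≡v = go
    where
    op : Odd p
    op with even-or-odd p
    ... | inj₂ o = o
    ... | inj₁ e = contradiction (+-even-odd p x e ox) (¬even×odd (p + x) (trans (cong parity p+x≡v) (*-evenʳ (suc k) y ey)))
    z∤p : z ∤ p
    z∤p z∣p = z∤x (∣m+n∣m⇒∣n (subst (z ∣_) (sym p+x≡v) (m*n∣⇒n∣ 2 z 2z∣v)) z∣p)
    go : Adj′ S p w → w ≡ suc k * y
    go (_ , here refl , inj₁ (k′ , _ , refl , refl)) = trans (+-comm x (k′ * x)) p+x≡v
    go (_ , here refl , inj₂ (k′ , ok′ , _ , refl)) =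
      contradiction op (¬even×odd (suc k′ * x) (*-evenˡ (suc k′) x (odd⇒suc-even k′ ok′)))
    go (_ , there (here refl) , inj₁ (k′ , _ , refl , _)) =
      contradiction op (¬even×odd (k′ * y) (*-evenʳ k′ y ey))
    go (_ , there (here refl) , inj₂ (k′ , _ , _ , refl)) =
      contradiction op (¬even×odd (suc k′ * y) (*-evenʳ (suc k′) y ey))
    go (_ , there (there (here refl)) , inj₁ (k′ , _ , eq , _)) = contradiction (divides k′ eq) z∤p
    go (_ , there (there (here refl)) , inj₂ (k′ , _ , _ , eq)) = contradiction (divides (suc k′) eq) z∤p

  -- The path `n`, `u`, `v`, `w`, `t` goes on beyond `w` without returning to `v`, so `w` is not the
  -- pendant vertex `v - x`. Hence `w = v - z = u - x = n`.
  closes : ∀ {n u v w t} → Bad u v → Adj′ S u n → Adj′ S v w → Adj′ S w t →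
           n ≢ v → w ≢ u → t ≢ v → n ≡ w
  closes {n} {u} {v} {w} bad@((k , _ , refl , refl) , _) un vw wt n≢v w≢u t≢v with upper-neighbour bad vw w≢u
  ... | inj₂ w+x≡v = contradiction (pendant bad w+x≡v wt) t≢v
  ... | inj₁ w+z≡v = +-cancelʳ-≡ z n w (trans eq (sym w+z≡v))
    where
    eq : n + z ≡ suc k * y
    eq = trans (sym (+-assoc n x y)) (trans (cong (_+ y) (lower-neighbour bad un n≢v)) (+-comm (k * y) y))

  -- An odd cycle must use a `Bad` edge. There `closes` identifies vertices three steps apart, so
  -- `L` divides 3.
  odd-cycle⇒3 : ∀ L → HasCycle S L → Odd L → L ≡ 3
  odd-cycle⇒3 1 (_ , s≤s () , _) _
  odd-cycle⇒3 L@(suc (suc l)) (f , 3≤L , inj , adj , closed) oL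
    with P , s∣P , f≤ ← reflection S (>-nonZero (>-nonZero⁻¹ x) ∷ >-nonZero (>-nonZero⁻¹ y) ∷ z≢0 ∷ []) f L =
    odd-closed-walk (χ ∘ h) L step oL (cong (λ r → χ (2 * P ∸ f r)) (n%n≡0 L))
    where
    h : ℕ → ℕ
    h i = 2 * P ∸ f (i % L)
    f≤% : ∀ i → f (i % L) ≤ 2 * P
    f≤% i = f≤ (i % L) (<⇒≤ (m%n<n i L))
    h-adj : ∀ i → Adj′ S (h i) (h (suc i))
    h-adj i = reflect s∣P (f≤% i) (f≤% (suc i))
      (subst (Adj S (f (i % L))) (sym (cyclic-step f L closed i)) (adj (i % L) (m%n<n i L)))
    h-inj : ∀ b j → h b ≡ h (b + j) → L ∣ j
    h-inj b j eq = %-≡⇒∣ b j L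
      (inj _ _ (m%n<n b L) (m%n<n (b + j) L) (∸-cancelˡ-≡ (f≤% b) (f≤% (b + j)) eq))
    h-≢ : ∀ b → h b ≢ h (2 + b)
    h-≢ b eq = >⇒∤ 3≤L (h-inj b 2 (trans eq (cong h (+-comm 2 b))))
    h-3 : ∀ b → h b ≡ h (3 + b) → L ≡ 3
    h-3 b eq = ≤-antisym (∣⇒≤ (h-inj b 3 (trans eq (cong h (+-comm 3 b))))) 3≤L
    -- `closes` looks one vertex beyond the lower end and two beyond the upper end; the indices from
    -- `b` to `5 + b` cover both directions of travel.
    window : ∀ b → Bad (h (2 + b)) (h (3 + b)) ⊎ Bad (h (3 + b)) (h (2 + b)) → L ≡ 3
    window b (inj₁ bad) = h-3 (1 + b)
      (closes bad (Adj′-sym (h-adj (1 + b))) (h-adj (3 + b)) (h-adj (4 + b))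
        (h-≢ (1 + b)) (h-≢ (2 + b) ∘ sym) (h-≢ (3 + b) ∘ sym))
    window b (inj₂ bad) = h-3 (1 + b) (sym
      (closes bad (h-adj (3 + b)) (Adj′-sym (h-adj (1 + b))) (Adj′-sym (h-adj b))
        (h-≢ (2 + b) ∘ sym) (h-≢ (1 + b)) (h-≢ b)))
    step : ∀ i → i < L → L ≡ 3 ⊎ χ (h (suc i)) ≡ χ (h i) ⁻¹
    step i _ = Sum.map₁ bad⇒3 (edge-colour (h-adj i))
      where
      -- Since `l = L - 2`, starting the window at `i + l` goes back two vertices from `i` without
      -- subtraction.
      shift : ∀ i → h (2 + (i + l)) ≡ h i
      shift i = cong (λ r → 2 * P ∸ f r) (trans (cong (_% L) (eq i l)) ([m+n]%n≡m%n i L))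
        where
        eq : ∀ i l → 2 + (i + l) ≡ i + suc (suc l)
        eq = solve-∀
      bad⇒3 : Bad (h i) (h (suc i)) ⊎ Bad (h (suc i)) (h i) → L ≡ 3
      bad⇒3 = window (i + l) ∘ subst₂ (λ u v → Bad u v ⊎ Bad v u) (sym (shift i)) (sym (shift (suc i)))

-- Permuting and scaling `S`, and the conclusion.

Adj-⊆ : ∀ {S T u v} → S ⊆ T → Adj S u v → Adj T u v
Adj-⊆ S⊆T (s , j , s∈S , e) = s , j , S⊆T s∈S , e

HasCycle-⊆ : ∀ {S T L} → S ⊆ T → HasCycle S L → HasCycle T L
HasCycle-⊆ S⊆T (f , 3≤L , inj , adj , closed) = f , 3≤L , inj , (λ i i<L → Adj-⊆ S⊆T (adj i i<L)) , closed

ForcesDisc2-⊆ : ∀ {S T} → S ⊆ T → ForcesDisc2 S → ForcesDisc2 T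
ForcesDisc2-⊆ S⊆T forces x isSign with s , k , s∈S , rest ← forces x isSign = s , k , S⊆T s∈S , rest

module _ (g : ℕ) .{{_ : NonZero g}} where

  arc-even : ∀ j s → 2 * j * (g * s) ≡ 2 * j * s * g
  arc-even j s = ring j s g where
    ring : ∀ j s g → 2 * j * (g * s) ≡ 2 * j * s * g
    ring = solve-∀

  arc-odd : ∀ j s → (2 * j + 1) * (g * s) ≡ (2 * j + 1) * s * g
  arc-odd j s = ring j s g where
    ring : ∀ j s g → (2 * j + 1) * (g * s) ≡ (2 * j + 1) * s * g
    ring = solve-∀

  Adj-scale : ∀ {S u v} → Adj S u v → Adj (map (g *_) S) (u * g) (v * g)
  Adj-scale (s , j , s∈S , inj₁ (refl , refl)) =
    g * s , j , ∈-map⁺ (g *_) s∈S , inj₁ (sym (arc-even j s) , sym (arc-odd j s))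
  Adj-scale (s , j , s∈S , inj₂ (refl , refl)) =
    g * s , j , ∈-map⁺ (g *_) s∈S , inj₂ (sym (arc-even j s) , sym (arc-odd j s))

  Adj-unscale : ∀ {S u v} → Adj (map (g *_) S) u v → Adj S (u / g) (v / g) × g ∣ u
  Adj-unscale {S} (_ , j , gs∈ , e) with s , s∈S , refl ← ∈-map⁻ (g *_) gs∈ = go e
    where
    even/ : 2 * j * (g * s) / g ≡ 2 * j * s
    even/ = trans (cong (_/ g) (arc-even j s)) (m*n/n≡m (2 * j * s) g)
    odd/ : (2 * j + 1) * (g * s) / g ≡ (2 * j + 1) * s
    odd/ = trans (cong (_/ g) (arc-odd j s)) (m*n/n≡m ((2 * j + 1) * s) g)
    go : ∀ {u v} → (u ≡ 2 * j * (g * s) × v ≡ (2 * j + 1) * (g * s)) ⊎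
         (v ≡ 2 * j * (g * s) × u ≡ (2 * j + 1) * (g * s)) →
         Adj S (u / g) (v / g) × g ∣ u
    go (inj₁ (refl , refl)) = (s , j , s∈S , inj₁ (even/ , odd/)) , divides (2 * j * s) (arc-even j s)
    go (inj₂ (refl , refl)) = (s , j , s∈S , inj₂ (even/ , odd/)) , divides ((2 * j + 1) * s) (arc-odd j s)

  HasCycle-scale : ∀ {S L} → HasCycle S L → HasCycle (map (g *_) S) L
  HasCycle-scale (f , 3≤L , inj , adj , closed) =
    (λ i → f i * g) , 3≤L , (λ i j i<L j<L eq → inj i j i<L j<L (*-cancelʳ-≡ (f i) (f j) g eq)) ,
    (λ i i<L → Adj-scale (adj i i<L)) , cong (_* g) closed

  -- Each vertex of the cycle is an end of an arc, hence a multiple of `g`, so dividing by `g` keeps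
  -- the vertices distinct.
  HasCycle-unscale : ∀ {S L} → HasCycle (map (g *_) S) L → HasCycle S L
  HasCycle-unscale (f , 3≤L , inj , adj , closed) =
    (λ i → f i / g) , 3≤L , (λ i j i<L j<L eq → inj i j i<L j<L (/-injective (g∣f i i<L) (g∣f j j<L) eq)) ,
    (λ i i<L → proj₁ (Adj-unscale (adj i i<L))) , cong (_/ g) closed
    where
    g∣f : ∀ i → i < _ → g ∣ f i
    g∣f i i<L = proj₂ (Adj-unscale (adj i i<L))
    /-injective : ∀ {m n} → g ∣ m → g ∣ n → m / g ≡ n / g → m ≡ n
    /-injective g∣m g∣n eq = trans (sym (m/n*n≡m g∣m)) (trans (cong (_* g) eq) (m/n*n≡m g∣n))

ForcingSet : List ℕ → Set
ForcingSet S = ForcesDisc2 S × HasCycle S 3 × (∀ L → L % 2 ≡ 1 → L ≢ 3 → ¬ HasCycle S L)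

ForcingSet-⊆ : ∀ {S T} → S ⊆ T → T ⊆ S → ForcingSet S → ForcingSet T
ForcingSet-⊆ S⊆T T⊆S (forces , cycle , unique) =
  ForcesDisc2-⊆ S⊆T forces , HasCycle-⊆ S⊆T cycle , λ L oL L≢3 c → unique L oL L≢3 (HasCycle-⊆ T⊆S c)

-- The triangle serves twice: as the cycle of length 3 and as the odd cycle that forces discrepancy
-- two.
forcing-scaled : ∀ g x y → .{{NonZero g}} → .{{NonZero x}} → .{{NonZero y}} → Odd x → Even y →
                 ForcingSet (g * x ∷ g * y ∷ g * (x + y) ∷ [])
forcing-scaled g x y ox ey = odd-cycle⇒forces (m*n≢0 g x ∷ m*n≢0 g y ∷ m*n≢0 g (x + y) ∷ []) cycle refl , cycle ,
  λ L oL L≢3 c → L≢3 (odd-cycle⇒3 L (HasCycle-unscale g c) (parity-% L oL))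
  where
  open NoLongOddCycle x y ox ey
  instance
    x+y≢0 : NonZero (x + y)
    x+y≢0 = z≢0
  cycle : HasCycle (g * x ∷ g * y ∷ g * (x + y) ∷ []) 3
  cycle = HasCycle-scale g (three-cycle x y ox ey)

-- Halving lowers both valuations by one, so `a` is still even when `b` becomes odd; `g` is the
-- power of 2 removed.
common-power : ∀ a b → .{{NonZero a}} → .{{NonZero b}} → ν₂ b < ν₂ a →
  ∃ λ g → ∃ λ x → ∃ λ y → Odd x × Even y × b ≡ g * x × a ≡ g * y
common-power a b = go a a b ≤-refl
  where
  go : ∀ f a b → a ≤ f → .{{NonZero a}} → .{{NonZero b}} → ν₂ b < ν₂ a →
       ∃ λ g → ∃ λ x → ∃ λ y → Odd x × Even y × b ≡ g * x × a ≡ g * y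
  go zero (suc a) b ()
  go (suc f) a b a≤1+f ν< with even-or-odd a | even-or-odd b
  ... | inj₂ oa | _ = contradiction (subst (ν₂ b <_) (ν₂-odd a oa) ν<) λ ()
  ... | inj₁ ea | inj₂ ob = 1 , b , a , ob , ea , sym (*-identityˡ b) , sym (*-identityˡ a)
  ... | inj₁ ea | inj₁ eb with even⇒2* a ea | even⇒2* b eb
  ... | a′@(suc _) , refl | b′@(suc _) , refl
    with g , x , y , ox , ey , b≡ , a≡ ← go f a′ b′ (half≤ a′ a≤1+f)
           (s≤s⁻¹ (subst₂ _<_ (ν₂-double b′) (ν₂-double a′) ν<)) =
    2 * g , x , y , ox , ey , trans (cong (2 *_) b≡) (sym (*-assoc 2 g x)) ,
    trans (cong (2 *_) a≡) (sym (*-assoc 2 g y))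

forcing-< : ∀ a b → .{{NonZero a}} → .{{NonZero b}} → ν₂ b < ν₂ a → ForcingSet (b ∷ a ∷ b + a ∷ [])
forcing-< a b ν< with g , x , y , ox , ey , refl , refl ← common-power a b ν< =
  subst (λ c → ForcingSet (g * x ∷ g * y ∷ c ∷ [])) (*-distribˡ-+ g x y)
    (forcing-scaled g x y {{m*n≢0⇒m≢0 g}} {{m*n≢0⇒n≢0 g}} {{m*n≢0⇒n≢0 g}} ox ey)

swap-⊆ : ∀ (m n : ℕ) S → m ∷ n ∷ S ⊆ n ∷ m ∷ S
swap-⊆ m n S (here refl) = there (here refl)
swap-⊆ m n S (there (here refl)) = here refl
swap-⊆ m n S (there (there s∈S)) = there (there s∈S)

forcing : ∀ a b c → 0 < a → 0 < b → a + b ≡ c × ν₂ a ≢ ν₂ b → ForcingSet (a ∷ b ∷ c ∷ [])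
forcing a@(suc _) b@(suc _) _ _ _ (refl , ν≢) with <-cmp (ν₂ a) (ν₂ b)
... | tri< ν< _ _ = forcing-< b a ν<
... | tri≈ _ ν≡ _ = contradiction ν≡ ν≢
... | tri> _ _ ν> = ForcingSet-⊆ (swap-⊆ b a _) (swap-⊆ a b _)
  (subst (λ c → ForcingSet (b ∷ a ∷ c ∷ [])) (+-comm b a) (forcing-< a b ν>))

theorem2 : (a b c : ℕ) → 0 < a → 0 < b → 0 < c → a ≢ b → a < c → b < c →
    (ForcesDisc2 (a ∷ b ∷ c ∷ []) ⇔ (a + b ≡ c × ν₂ a ≢ ν₂ b)) ×
    ((a + b ≡ c × ν₂ a ≢ ν₂ b) →
    HasCycle (a ∷ b ∷ c ∷ []) 3 ×
    (∀ L → L % 2 ≡ 1 → L ≢ 3 → ¬ HasCycle (a ∷ b ∷ c ∷ []) L))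
theorem2 a b c 0<a 0<b 0<c a≢b a<c b<c =
  -- A colouring only refutes the failure of the condition; decidability of the condition removes
  -- the double negation.
  mk⇔ (λ forces → decidable-stable ((a + b ≟ c) ×-dec ¬? (ν₂ a ≟ ν₂ b))
         λ ¬cond → colourable⇒¬forces a b c (colourable a b c 0<a 0<b a≢b a<c b<c ¬cond) forces)
      (proj₁ ∘ forcing a b c 0<a 0<b) ,
  proj₂ ∘ forcing a b c 0<a 0<b
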